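{- The universal subgraph membership problem is undecidable: there is no algorithm that, given a graph grammar $\mathcal{G}$ over a signature $\Sigma$ and a graph $G$ over $\Sigma$, decides whether $G\in\widehat{\mathrm{L}(\mathcal{G})}$.
   Context: Graphs over a signature $\Sigma=(\Sigma_V,\Sigma_E)$ (finite label sets) are finite directed graphs with node labels in $\Sigma_V$ and edge labels in $\Sigma_E$. Rules are pairs of inclusions $\langle L\leftarrow K\rightarrow R\rangle$ applied by double-pushout graph transformation with injective matches; $\Rightarrow^*_\mathcal{R}$ is the reflexive (up to isomorphism) transitive closure of one-step rewriting with rules in $\mathcal{R}$. A graph grammar is $\mathcal{G}=(\Sigma,N,\mathcal{R},S)$ with $\mathcal{R}$ a finite set of rules over $\Sigma$, $N=(N_V,N_E)$ a subsignature of non-terminal labels, and $S$ a start graph; a graph is terminally labelled if no node label lies in $N_V$ and no edge label in $N_E$; $\mathrm{L}(\mathcal{G})=\{G\mid S\Rightarrow^*_\mathcal{R}G,\ G \text{ terminally labelled}\}$. For a language $\mathcal{D}$, $\widehat{\mathcal{D}}$ is the smallest language containing $\mathcal{D}$ that is closed under taking subgraphs. -}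

module Defs where

open import Level using (Level)
open import Data.Nat using (ℕ; zero; suc)
open import Data.Fin using (Fin)
open import Data.Bool using (Bool; true; false)
open import Data.List using (List; []; _∷_)
open import Data.Maybe using (Maybe; just; nothing)
open import Data.Product using (Σ; _×_; _,_; ∃; ∃-syntax)
open import Function.Definitions using (Injective)
open import Relation.Binary.PropositionalEquality using (_≡_)

-- Signatures: finite label sets Σ_V = Fin nV, Σ_E = Fin nE

record Signature : Set where
  field
    nV : ℕ
    nE : ℕ
open Signature public

record Graph (S : Signature) : Set where
  field
    nodes : ℕ
    edges : ℕ
    src   : Fin edges → Fin nodes
    tgt   : Fin edges → Fin nodes
    vlab  : Fin nodes → Fin (nV S)
    elab  : Fin edges → Fin (nE S)
open Graph public

record Hom {S : Signature} (A B : Graph S) : Set where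
  field
    vmap   : Fin (nodes A) → Fin (nodes B)
    emap   : Fin (edges A) → Fin (edges B)
    src-ok : ∀ e → src B (emap e) ≡ vmap (src A e)
    tgt-ok : ∀ e → tgt B (emap e) ≡ vmap (tgt A e)
    vlab-ok : ∀ v → vlab B (vmap v) ≡ vlab A v
    elab-ok : ∀ e → elab B (emap e) ≡ elab A e
open Hom public

module _ {S : Signature} where

  idH : (A : Graph S) → Hom A A
  idH A = record { vmap = λ v → v ; emap = λ e → e
                 ; src-ok = λ e → Relation.Binary.PropositionalEquality.refl
                 ; tgt-ok = λ e → Relation.Binary.PropositionalEquality.refl
                 ; vlab-ok = λ v → Relation.Binary.PropositionalEquality.refl
                 ; elab-ok = λ e → Relation.Binary.PropositionalEquality.refl }

  _∘H_ : {A B C : Graph S} → Hom B C → Hom A B → Hom A C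
  _∘H_ {A} {B} {C} g f = record
    { vmap = λ v → vmap g (vmap f v)
    ; emap = λ e → emap g (emap f e)
    ; src-ok = λ e → trans (src-ok g (emap f e)) (cong (vmap g) (src-ok f e))
    ; tgt-ok = λ e → trans (tgt-ok g (emap f e)) (cong (vmap g) (tgt-ok f e))
    ; vlab-ok = λ v → trans (vlab-ok g (vmap f v)) (vlab-ok f v)
    ; elab-ok = λ e → trans (elab-ok g (emap f e)) (elab-ok f e) }
    where open Relation.Binary.PropositionalEquality using (trans; cong)

  _≈H_ : {A B : Graph S} → Hom A B → Hom A B → Set
  f ≈H g = (∀ v → vmap f v ≡ vmap g v) × (∀ e → emap f e ≡ emap g e)

  IsInjective : {A B : Graph S} → Hom A B → Set
  IsInjective f = Injective _≡_ _≡_ (vmap f) × Injective _≡_ _≡_ (emap f)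

  _≅_ : Graph S → Graph S → Set
  A ≅ B = Σ (Hom A B) λ f → Σ (Hom B A) λ g →
            ((g ∘H f) ≈H idH A) × ((f ∘H g) ≈H idH B)

  record IsPushout {A B C D : Graph S}
         (f : Hom A B) (g : Hom A C) (i : Hom B D) (j : Hom C D) : Set₁ where
    field
      commutes  : (i ∘H f) ≈H (j ∘H g)
      mediate   : (X : Graph S) (h : Hom B X) (k : Hom C X) →
                  (h ∘H f) ≈H (k ∘H g) →
                  Σ (Hom D X) λ u → ((u ∘H i) ≈H h) × ((u ∘H j) ≈H k)
      unique    : (X : Graph S) (u u' : Hom D X) →
                  (u ∘H i) ≈H (u' ∘H i) → (u ∘H j) ≈H (u' ∘H j) → u ≈H u'

  record Rule : Set where
    field
      L K R : Graph S
      l     : Hom K L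
      r     : Hom K R
      l-inj : IsInjective l
      r-inj : IsInjective r
  open Rule public

  _⇒[_]_ : Graph S → Rule → Graph S → Set₁
  G ⇒[ ρ ] H =
    Σ (Hom (L ρ) G) λ m → IsInjective m ×
    (Σ (Graph S) λ D → Σ (Hom (K ρ) D) λ k →
     Σ (Hom D G) λ lD → Σ (Hom (R ρ) H) λ n → Σ (Hom D H) λ rD →
       IsPushout (l ρ) k m lD × IsPushout (r ρ) k n rD)

  data _∈R_ (ρ : Rule) : List Rule → Set where
    here  : ∀ {rs} → ρ ∈R (ρ ∷ rs)
    there : ∀ {ρ' rs} → ρ ∈R rs → ρ ∈R (ρ' ∷ rs)

  data _⇒*[_]_ : Graph S → List Rule → Graph S → Set₁ where
    done : ∀ {G H rs} → G ≅ H → G ⇒*[ rs ] H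
    step : ∀ {G G' H rs} (ρ : Rule) → ρ ∈R rs →
           G ⇒[ ρ ] G' → G' ⇒*[ rs ] H → G ⇒*[ rs ] H

record Grammar (S : Signature) : Set where
  field
    NV    : Fin (nV S) → Bool
    NE    : Fin (nE S) → Bool
    rules : List (Rule {S})
    start : Graph S
open Grammar public

TerminallyLabelled : {S : Signature} → Grammar S → Graph S → Set
TerminallyLabelled 𝒢 G =
  (∀ v → NV 𝒢 (vlab G v) ≡ false) × (∀ e → NE 𝒢 (elab G e) ≡ false)

InLang : {S : Signature} → Grammar S → Graph S → Set₁
InLang 𝒢 G = (start 𝒢 ⇒*[ rules 𝒢 ] G) × TerminallyLabelled 𝒢 G

-- subgraph closure: G ∈ \hat{D} iff G is (isomorphic to) a subgraph of a
-- member of D, i.e. there is an injective morphism G → D with D ∈ D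
SubgraphClosure : {S : Signature} → (Graph S → Set₁) → Graph S → Set₁
SubgraphClosure 𝒟 G =
  Σ (Graph _) λ D → 𝒟 D × Σ (Hom G D) IsInjective

-- Reference undecidable problem: halting of Minsky two-counter machines
-- started with both counters 0 (Minsky 1961/1967).

data Reg : Set where
  r₀ r₁ : Reg

data Instr : Set where
  inc : Reg → ℕ → Instr
  dec : Reg → ℕ → ℕ → Instr      -- if reg = 0 jump to 2nd label,
                                 -- else decrement and jump to 1st label

Program : Set
Program = List Instr

record Config : Set where
  constructor ⟨_,_,_⟩
  field
    pc : ℕ
    c₀ : ℕ
    c₁ : ℕ

nth : List Instr → ℕ → Maybe Instr
nth []       _       = nothing
nth (x ∷ xs) zero    = just x
nth (x ∷ xs) (suc n) = nth xs n

private
  get : Reg → Config → ℕ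
  get r₀ ⟨ _ , a , _ ⟩ = a
  get r₁ ⟨ _ , _ , b ⟩ = b

  set : Reg → ℕ → Config → Config
  set r₀ x ⟨ p , _ , b ⟩ = ⟨ p , x , b ⟩
  set r₁ x ⟨ p , a , _ ⟩ = ⟨ p , a , x ⟩

  jump : ℕ → Config → Config
  jump p ⟨ _ , a , b ⟩ = ⟨ p , a , b ⟩

  execDec : Reg → ℕ → ℕ → Config → ℕ → Config
  execDec r j k c zero    = jump k c
  execDec r j k c (suc x) = jump j (set r x c)

-- one step; nothing = machine has halted (pc outside the program)
stepCM : Program → Config → Maybe Config
stepCM P c with nth P (Config.pc c)
... | nothing        = nothing
... | just (inc r j) = just (jump j (set r (suc (get r c)) c))
... | just (dec r j k) = just (execDec r j k c (get r c))

runCM : Program → ℕ → Config → Maybe Config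
runCM P zero    c = just c
runCM P (suc n) c with stepCM P c
... | nothing = nothing
... | just c' = runCM P n c'

Halts : Program → Set
Halts P = ∃[ n ] runCM P n ⟨ 0 , 0 , 0 ⟩ ≡ nothing

-- A two-counter machine P is simulated by a graph grammar. A configuration ⟨q, a, b⟩ is a graph
-- with a control node labelled by the state q and one pointer edge per register, pointing at the
-- end of a chain of succ-edges of length a (resp. b) that starts at a node with a zero loop.
-- Each instruction becomes rules that replace the control node: an increment appends a chain node,
-- a decrement moves the pointer back along a succ-edge, a zero test requires the zero loop.
-- States inside P are non-terminal labels and every state outside P is the terminal label halt,
-- so P halts iff a lone halt node is a subgraph of a terminally labelled derived graph.
-- If P halts, the grammar simply simulates the run. Conversely, every derived graph maps
-- homomorphically (not necessarily injectively) into the graph T m tracing the first m steps of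
-- the run, because every rule application can be followed one step further along the run; a halt
-- node can only map to a control node whose program counter lies outside P.

module Submission where

open import Defs
open import Data.Empty using (⊥-elim)
open import Data.Fin as Fin using (Fin; zero; suc; _↑ˡ_; _↑ʳ_; splitAt; toℕ; fromℕ<; inject₁)
open import Data.Fin.Properties
  using (suc-injective; toℕ-injective; toℕ-fromℕ<; toℕ-inject₁; toℕ≤pred[n]; splitAt-↑ˡ; splitAt-↑ʳ;
         ↑ˡ-injective; ↑ʳ-injective; +↔⊎; *↔×; 1↔⊤)
open import Data.Nat using (ℕ; zero; suc; _+_; _*_; _≤_; _<_; z≤n; s≤s)
open import Data.Nat.Properties using (_<?_; <⇒≱; ≮⇒≥; +-identityʳ; +-suc; ≤-refl; ≤-trans; n≤1+n)
open import Data.Bool using (Bool; true; false)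
open import Data.Maybe using (just; nothing; maybe′)
open import Data.List using (List; []; _∷_; _++_; length)
open import Data.List.Membership.Propositional using (_∈_)
open import Data.List.Membership.Propositional.Properties using (∈-++⁺ˡ; ∈-++⁺ʳ; ∈-++⁻)
open import Data.List.Relation.Unary.Any using (here; there)
open import Data.Product using (Σ; _×_; _,_; proj₁; proj₂)
open import Data.Sum using (_⊎_; inj₁; inj₂; [_,_]′)
open import Data.Sum.Properties using ([,]-cong; [,]-∘; inj₂-injective)
open import Function using (_∘_; id)
open import Function.Definitions using (Injective)
open import Function.Bundles using (_↔_; Inverse; mk↔ₛ′)
open import Function.Properties.Inverse using (↔-refl; ↔-sym; ↔-trans)
open import Data.Sum.Function.Propositional using (_⊎-↔_)
open import Data.Product.Function.NonDependent.Propositional using (_×-↔_)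
open import Data.Unit using (⊤; tt)
open Inverse using (to; from; strictlyInverseˡ; strictlyInverseʳ)
open import Relation.Binary.Definitions using (DecidableEquality)
open import Relation.Nullary using (Dec; yes; no)
open import Relation.Binary.PropositionalEquality

caseFin : ∀ {A : Set} m {n} → (Fin m → A) → (Fin n → A) → Fin (m + n) → A
caseFin m f g i = [ f , g ]′ (splitAt m i)

module _ {A : Set} {m n : ℕ} (f : Fin m → A) (g : Fin n → A) where

  caseFin-↑ˡ : ∀ i → caseFin m f g (i ↑ˡ n) ≡ f i
  caseFin-↑ˡ i = cong [ f , g ]′ (splitAt-↑ˡ m i n)

  caseFin-↑ʳ : ∀ j → caseFin m f g (m ↑ʳ j) ≡ g j
  caseFin-↑ʳ j = cong [ f , g ]′ (splitAt-↑ʳ m n j)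

caseFin-cong : ∀ {A : Set} m {n} {f f′ : Fin m → A} {g g′ : Fin n → A} →
               (∀ i → f i ≡ f′ i) → (∀ j → g j ≡ g′ j) → ∀ i → caseFin m f g i ≡ caseFin m f′ g′ i
caseFin-cong m f≗f′ g≗g′ i = [,]-cong f≗f′ g≗g′ (splitAt m i)

caseFin-∘ : ∀ {A B : Set} m {n} (h : A → B) (f : Fin m → A) (g : Fin n → A) →
            ∀ i → h (caseFin m f g i) ≡ caseFin m (h ∘ f) (h ∘ g) i
caseFin-∘ m h f g i = [,]-∘ h (splitAt m i)

data SplitView (m n : ℕ) : Fin (m + n) → Set where
  left  : (i : Fin m) → SplitView m n (i ↑ˡ n)
  right : (j : Fin n) → SplitView m n (m ↑ʳ j)

splitView : ∀ m n (i : Fin (m + n)) → SplitView m n i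
splitView zero    n i       = right i
splitView (suc m) n zero    = left zero
splitView (suc m) n (suc i) with splitView m n i
... | left j  = left (suc j)
... | right j = right j

↑ˡ≢↑ʳ : ∀ {m n} (i : Fin m) (j : Fin n) → i ↑ˡ n ≢ m ↑ʳ j
↑ˡ≢↑ʳ zero    j ()
↑ˡ≢↑ʳ (suc i) j eq = ↑ˡ≢↑ʳ i j (suc-injective eq)

split-ext : ∀ {A : Set} m {n} {u u′ : Fin (m + n) → A} →
            (∀ i → u (i ↑ˡ n) ≡ u′ (i ↑ˡ n)) → (∀ j → u (m ↑ʳ j) ≡ u′ (m ↑ʳ j)) → ∀ i → u i ≡ u′ i
split-ext m {n} onˡ onʳ i with splitView m n i
... | left i′ = onˡ i′
... | right j = onʳ j

caseFin-unique : ∀ {A : Set} m {n} {f : Fin m → A} {g : Fin n → A} (u : Fin (m + n) → A) →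
                 (∀ i → u (i ↑ˡ n) ≡ f i) → (∀ j → u (m ↑ʳ j) ≡ g j) → ∀ i → u i ≡ caseFin m f g i
caseFin-unique m {f = f} {g} u uˡ uʳ =
  split-ext m (λ i → trans (uˡ i) (sym (caseFin-↑ˡ f g i))) (λ j → trans (uʳ j) (sym (caseFin-↑ʳ f g j)))

extendMap : ∀ m {n n′} → (Fin n → Fin n′) → Fin (m + n) → Fin (m + n′)
extendMap m {n′ = n′} h = caseFin m (_↑ˡ n′) ((m ↑ʳ_) ∘ h)

module _ (m : ℕ) {n n′ : ℕ} (h : Fin n → Fin n′) where

  extendMap-↑ˡ : ∀ i → extendMap m h (i ↑ˡ n) ≡ i ↑ˡ n′
  extendMap-↑ˡ = caseFin-↑ˡ (_↑ˡ n′) ((m ↑ʳ_) ∘ h)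

  extendMap-↑ʳ : ∀ j → extendMap m h (m ↑ʳ j) ≡ m ↑ʳ h j
  extendMap-↑ʳ = caseFin-↑ʳ (_↑ˡ n′) ((m ↑ʳ_) ∘ h)

  extendMap-injective : Injective _≡_ _≡_ h → Injective _≡_ _≡_ (extendMap m h)
  extendMap-injective h-inj {x} {y} eq with splitView m n x | splitView m n y
  ... | left i  | left i′  =
    cong (_↑ˡ n) (↑ˡ-injective n′ i i′ (trans (sym (extendMap-↑ˡ i)) (trans eq (extendMap-↑ˡ i′))))
  ... | left i  | right j  = ⊥-elim (↑ˡ≢↑ʳ i (h j) (trans (sym (extendMap-↑ˡ i)) (trans eq (extendMap-↑ʳ j))))
  ... | right j | left i   = ⊥-elim (↑ˡ≢↑ʳ i (h j) (trans (sym (extendMap-↑ˡ i)) (trans (sym eq) (extendMap-↑ʳ j))))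
  ... | right j | right j′ =
    cong (m ↑ʳ_) (h-inj (↑ʳ-injective m (h j) (h j′) (trans (sym (extendMap-↑ʳ j)) (trans eq (extendMap-↑ʳ j′)))))

caseFin-extendMap : ∀ {A : Set} m {n n′} (f : Fin m → A) (g : Fin n′ → A) (h : Fin n → Fin n′) →
                    ∀ i → caseFin m f g (extendMap m h i) ≡ caseFin m f (g ∘ h) i
caseFin-extendMap m f g h =
  caseFin-unique m (caseFin m f g ∘ extendMap m h)
    (λ i → trans (cong (caseFin m f g) (extendMap-↑ˡ m h i)) (caseFin-↑ˡ f g i))
    (λ j → trans (cong (caseFin m f g) (extendMap-↑ʳ m h j)) (caseFin-↑ʳ f g (h j)))

attach : ∀ a {k n} → (Fin k → Fin n) → Fin a ⊎ Fin k → Fin (a + n)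
attach a {n = n} f = [ _↑ˡ n , (a ↑ʳ_) ∘ f ]′

extendMap-attach : ∀ a {k n n′} (f : Fin k → Fin n) (h : Fin n → Fin n′) z →
                   extendMap a h (attach a f z) ≡ attach a (h ∘ f) z
extendMap-attach a f h (inj₁ i) = extendMap-↑ˡ a h i
extendMap-attach a f h (inj₂ κ) = extendMap-↑ʳ a h (f κ)

data End : Set where
  source target : End

module _ {S : Signature} where

  end : End → (G : Graph S) → Fin (edges G) → Fin (nodes G)
  end source = src
  end target = tgt

  end-preserved : {A B : Graph S} (f : Hom A B) → ∀ s e → end s B (emap f e) ≡ vmap f (end s A e)
  end-preserved f source = src-ok f
  end-preserved f target = tgt-ok f

  mkHom : {A B : Graph S} (vm : Fin (nodes A) → Fin (nodes B)) (em : Fin (edges A) → Fin (edges B)) →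
          (∀ s e → end s B (em e) ≡ vm (end s A e)) →
          (∀ v → vlab B (vm v) ≡ vlab A v) → (∀ e → elab B (em e) ≡ elab A e) → Hom A B
  mkHom vm em ends-ok vlab-ok elab-ok = record
    { vmap = vm ; emap = em ; src-ok = ends-ok source ; tgt-ok = ends-ok target
    ; vlab-ok = vlab-ok ; elab-ok = elab-ok }

  ≅-refl : {A : Graph S} → A ≅ A
  ≅-refl {A} = idH A , idH A , ((λ _ → refl) , (λ _ → refl)) , ((λ _ → refl) , (λ _ → refl))

  ≅-sym : {A B : Graph S} → A ≅ B → B ≅ A
  ≅-sym (φ , ψ , ψφ , φψ) = ψ , φ , φψ , ψφ

  ≅-pointwise : ∀ {n m} {s s′ t t′ : Fin m → Fin n} {vl vl′ : Fin n → Fin (nV S)} {el el′ : Fin m → Fin (nE S)} →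
                (∀ e → s e ≡ s′ e) → (∀ e → t e ≡ t′ e) → (∀ v → vl v ≡ vl′ v) → (∀ e → el e ≡ el′ e) →
                record { nodes = n ; edges = m ; src = s ; tgt = t ; vlab = vl ; elab = el } ≅
                record { nodes = n ; edges = m ; src = s′ ; tgt = t′ ; vlab = vl′ ; elab = el′ }
  ≅-pointwise s≗ t≗ vl≗ el≗ =
    record { vmap = id ; emap = id ; src-ok = sym ∘ s≗ ; tgt-ok = sym ∘ t≗
           ; vlab-ok = sym ∘ vl≗ ; elab-ok = sym ∘ el≗ } ,
    record { vmap = id ; emap = id ; src-ok = s≗ ; tgt-ok = t≗ ; vlab-ok = vl≗ ; elab-ok = el≗ } ,
    ((λ _ → refl) , (λ _ → refl)) , ((λ _ → refl) , (λ _ → refl))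

  ≅⇒injective : {A B : Graph S} (φ : A ≅ B) → IsInjective (proj₁ φ)
  ≅⇒injective (φ , ψ , ψφ , _) =
    (λ {x} {y} eq → trans (sym (proj₁ ψφ x)) (trans (cong (vmap ψ) eq) (proj₁ ψφ y))) ,
    (λ {x} {y} eq → trans (sym (proj₂ ψφ x)) (trans (cong (emap ψ) eq) (proj₂ ψφ y)))

  ∘H-injective : {A B C : Graph S} {g : Hom B C} {f : Hom A B} →
                 IsInjective g → IsInjective f → IsInjective (g ∘H f)
  ∘H-injective (gv , ge) (fv , fe) = fv ∘ gv , fe ∘ ge

  IsPushout-≅ : {A B C D D′ : Graph S} {f : Hom A B} {g : Hom A C} {i : Hom B D} {j : Hom C D} →
                IsPushout f g i j → (φ : D ≅ D′) → IsPushout f g (proj₁ φ ∘H i) (proj₁ φ ∘H j)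
  IsPushout-≅ {i = i} {j} po (φ , ψ , ψφ , φψ) = record
    { commutes = (λ v → cong (vmap φ) (proj₁ commutes v)) , (λ e → cong (emap φ) (proj₂ commutes e))
    ; mediate  = λ Y h k hk →
        let (u , ui , uj) = mediate Y h k hk in
        (u ∘H ψ) ,
        ((λ v → trans (cong (vmap u) (proj₁ ψφ (vmap i v))) (proj₁ ui v)) ,
         (λ e → trans (cong (emap u) (proj₂ ψφ (emap i e))) (proj₂ ui e))) ,
        ((λ v → trans (cong (vmap u) (proj₁ ψφ (vmap j v))) (proj₁ uj v)) ,
         (λ e → trans (cong (emap u) (proj₂ ψφ (emap j e))) (proj₂ uj e)))
    ; unique   = λ Y w w′ wi wj →
        let (same-v , same-e) = unique Y (w ∘H φ) (w′ ∘H φ) wi wj in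
        (λ v → trans (cong (vmap w) (sym (proj₁ φψ v)))
                 (trans (same-v (vmap ψ v)) (cong (vmap w′) (proj₁ φψ v)))) ,
        (λ e → trans (cong (emap w) (sym (proj₂ φψ e)))
                 (trans (same-e (emap ψ e)) (cong (emap w′) (proj₂ φψ e)))) }
    where open IsPushout po

  ∈⇒∈R : ∀ {ρ : Rule {S}} {rs} → ρ ∈ rs → ρ ∈R rs
  ∈⇒∈R (here refl) = here
  ∈⇒∈R (there m)   = there (∈⇒∈R m)

  ∈R⇒∈ : ∀ {ρ : Rule {S}} {rs} → ρ ∈R rs → ρ ∈ rs
  ∈R⇒∈ here      = here refl
  ∈R⇒∈ (there m) = there (∈R⇒∈ m)

  -- New nodes and edges to be added to a graph with k distinguished interface nodes;
  -- a new edge may end at a new node (inj₁) or at an interface node (inj₂).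
  record Extension (k : ℕ) : Set where
    field
      newNodes newEdges : ℕ
      newVlab : Fin newNodes → Fin (nV S)
      newElab : Fin newEdges → Fin (nE S)
      newSrc newTgt : Fin newEdges → Fin newNodes ⊎ Fin k

    newEnd : End → Fin newEdges → Fin newNodes ⊎ Fin k
    newEnd source = newSrc
    newEnd target = newTgt
  open Extension

  extendedEnd : (D : Graph S) {k : ℕ} (X : Extension k) → (Fin k → Fin (nodes D)) →
                End → Fin (newEdges X + edges D) → Fin (newNodes X + nodes D)
  extendedEnd D X f s = caseFin (newEdges X) (attach (newNodes X) f ∘ newEnd X s) ((newNodes X ↑ʳ_) ∘ end s D)

  extend : (D : Graph S) {k : ℕ} (X : Extension k) → (Fin k → Fin (nodes D)) → Graph S
  extend D X f = record
    { nodes = newNodes X + nodes D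
    ; edges = newEdges X + edges D
    ; src   = extendedEnd D X f source
    ; tgt   = extendedEnd D X f target
    ; vlab  = caseFin (newNodes X) (newVlab X) (vlab D)
    ; elab  = caseFin (newEdges X) (newElab X) (elab D) }

  end-extend : (D : Graph S) {k : ℕ} (X : Extension k) (f : Fin k → Fin (nodes D)) →
               ∀ s e → end s (extend D X f) e ≡ extendedEnd D X f s e
  end-extend D X f source e = refl
  end-extend D X f target e = refl

  end-extend-↑ʳ : (D : Graph S) {k : ℕ} (X : Extension k) (f : Fin k → Fin (nodes D)) →
                  ∀ s e → end s (extend D X f) (newEdges X ↑ʳ e) ≡ newNodes X ↑ʳ end s D e
  end-extend-↑ʳ D X f s e =
    trans (end-extend D X f s _) (caseFin-↑ʳ (attach (newNodes X) f ∘ newEnd X s) ((newNodes X ↑ʳ_) ∘ end s D) e)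

  end-extend-↑ˡ : (D : Graph S) {k : ℕ} (X : Extension k) (f : Fin k → Fin (nodes D)) →
                  ∀ s i → end s (extend D X f) (i ↑ˡ edges D) ≡ attach (newNodes X) f (newEnd X s i)
  end-extend-↑ˡ D X f s i =
    trans (end-extend D X f s _) (caseFin-↑ˡ (attach (newNodes X) f ∘ newEnd X s) ((newNodes X ↑ʳ_) ∘ end s D) i)

  embed : (D : Graph S) {k : ℕ} (X : Extension k) (f : Fin k → Fin (nodes D)) → Hom D (extend D X f)
  embed D X f = record
    { vmap    = newNodes X ↑ʳ_
    ; emap    = newEdges X ↑ʳ_
    ; src-ok  = end-extend-↑ʳ D X f source
    ; tgt-ok  = end-extend-↑ʳ D X f target
    ; vlab-ok = caseFin-↑ʳ (newVlab X) (vlab D)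
    ; elab-ok = caseFin-↑ʳ (newElab X) (elab D) }

  embed-injective : (D : Graph S) {k : ℕ} (X : Extension k) (f : Fin k → Fin (nodes D)) →
                    IsInjective (embed D X f)
  embed-injective D X f = ↑ʳ-injective (newNodes X) _ _ , ↑ʳ-injective (newEdges X) _ _

  extensionRule : (K : Graph S) → Extension (nodes K) → Extension (nodes K) → Rule
  extensionRule K XL XR = record
    { L = extend K XL id ; K = K ; R = extend K XR id
    ; l = embed K XL id ; r = embed K XR id
    ; l-inj = embed-injective K XL id ; r-inj = embed-injective K XR id }

  module Copair {D B : Graph S} {k : ℕ} (X : Extension k) (f : Fin k → Fin (nodes D)) (h : Hom D B)
           (newV : Fin (newNodes X) → Fin (nodes B)) (newE : Fin (newEdges X) → Fin (edges B))
           (newEnds-ok : ∀ s i → end s B (newE i) ≡ [ newV , vmap h ∘ f ]′ (newEnd X s i))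
           (newVlab-ok : ∀ i → vlab B (newV i) ≡ newVlab X i)
           (newElab-ok : ∀ i → elab B (newE i) ≡ newElab X i) where

    private
      a = newNodes X
      b = newEdges X
      uv = caseFin a newV (vmap h)

    copair : Hom (extend D X f) B
    copair = mkHom uv (caseFin b newE (emap h)) ends-ok
      (λ v → trans (caseFin-∘ a (vlab B) _ _ v) (caseFin-cong a newVlab-ok (vlab-ok h) v))
      (λ e → trans (caseFin-∘ b (elab B) _ _ e) (caseFin-cong b newElab-ok (elab-ok h) e))
      where
      uv-attach : ∀ z → uv (attach a f z) ≡ [ newV , vmap h ∘ f ]′ z
      uv-attach (inj₁ i) = caseFin-↑ˡ newV (vmap h) i
      uv-attach (inj₂ κ) = caseFin-↑ʳ newV (vmap h) (f κ)
      ends-ok : ∀ s e → end s B (caseFin b newE (emap h) e) ≡ uv (end s (extend D X f) e)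
      ends-ok s e = begin
        end s B (caseFin b newE (emap h) e)
          ≡⟨ caseFin-∘ b (end s B) _ _ e ⟩
        caseFin b (end s B ∘ newE) (end s B ∘ emap h) e
          ≡⟨ caseFin-cong b (λ i → trans (newEnds-ok s i) (sym (uv-attach (newEnd X s i))))
                            (λ d → trans (end-preserved h s d) (sym (caseFin-↑ʳ newV (vmap h) (end s D d)))) e ⟩
        caseFin b (uv ∘ attach a f ∘ newEnd X s) (uv ∘ (a ↑ʳ_) ∘ end s D) e
          ≡⟨ caseFin-∘ b uv _ _ e ⟨
        uv (extendedEnd D X f s e)
          ≡⟨ cong uv (end-extend D X f s e) ⟨
        uv (end s (extend D X f) e) ∎
        where open ≡-Reasoning

    copair-embed : (copair ∘H embed D X f) ≈H h
    copair-embed = caseFin-↑ʳ newV (vmap h) , caseFin-↑ʳ newE (emap h)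

  -- Extending K and D by the same X along k : K → D is a pushout of the inclusion K → K + X along k.
  module ExtensionPushout {K D : Graph S} (X : Extension (nodes K)) (k : Hom K D) where

    private
      a = newNodes X
      b = newEdges X
      KX = extend K X id
      DX = extend D X (vmap k)

    extendHom : Hom KX DX
    extendHom = mkHom (extendMap a (vmap k)) (extendMap b (emap k)) ends-ok vlab-ok′ elab-ok′
      where
      ends-ok : ∀ s e → end s DX (extendMap b (emap k) e) ≡ extendMap a (vmap k) (end s KX e)
      ends-ok s e = begin
        end s DX (extendMap b (emap k) e)
          ≡⟨ end-extend D X (vmap k) s _ ⟩
        caseFin b (attach a (vmap k) ∘ newEnd X s) ((a ↑ʳ_) ∘ end s D) (extendMap b (emap k) e)
          ≡⟨ caseFin-extendMap b _ _ (emap k) e ⟩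
        caseFin b (attach a (vmap k) ∘ newEnd X s) ((a ↑ʳ_) ∘ end s D ∘ emap k) e
          ≡⟨ caseFin-cong b (λ i → sym (extendMap-attach a id (vmap k) (newEnd X s i)))
                            (λ d → trans (cong (a ↑ʳ_) (end-preserved k s d)) (sym (extendMap-↑ʳ a (vmap k) _))) e ⟩
        caseFin b (extendMap a (vmap k) ∘ attach a id ∘ newEnd X s) (extendMap a (vmap k) ∘ (a ↑ʳ_) ∘ end s K) e
          ≡⟨ caseFin-∘ b (extendMap a (vmap k)) _ _ e ⟨
        extendMap a (vmap k) (extendedEnd K X id s e)
          ≡⟨ cong (extendMap a (vmap k)) (end-extend K X id s e) ⟨
        extendMap a (vmap k) (end s KX e) ∎
        where open ≡-Reasoning
      vlab-ok′ : ∀ v → vlab DX (extendMap a (vmap k) v) ≡ vlab KX v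
      vlab-ok′ v = trans (caseFin-extendMap a (newVlab X) (vlab D) (vmap k) v)
                         (caseFin-cong a (λ _ → refl) (vlab-ok k) v)
      elab-ok′ : ∀ e → elab DX (extendMap b (emap k) e) ≡ elab KX e
      elab-ok′ e = trans (caseFin-extendMap b (newElab X) (elab D) (emap k) e)
                         (caseFin-cong b (λ _ → refl) (elab-ok k) e)

    extendHom-injective : IsInjective k → IsInjective extendHom
    extendHom-injective (kv , ke) = extendMap-injective a (vmap k) kv , extendMap-injective b (emap k) ke

    module Mediator (Y : Graph S) (h : Hom KX Y) (g : Hom D Y) (hg : (h ∘H embed K X id) ≈H (g ∘H k)) where

      h-attach : ∀ z → vmap h (attach a id z) ≡ [ vmap h ∘ (_↑ˡ nodes K) , vmap g ∘ vmap k ]′ z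
      h-attach (inj₁ i) = refl
      h-attach (inj₂ κ) = proj₁ hg κ

      open Copair X (vmap k) g (vmap h ∘ (_↑ˡ nodes K)) (emap h ∘ (_↑ˡ edges K))
        (λ s i → trans (end-preserved h s _)
                   (trans (cong (vmap h) (end-extend-↑ˡ K X id s i)) (h-attach (newEnd X s i))))
        (λ i → trans (vlab-ok h _) (caseFin-↑ˡ (newVlab X) (vlab K) i))
        (λ i → trans (elab-ok h _) (caseFin-↑ˡ (newElab X) (elab K) i))
        public renaming (copair to mediator; copair-embed to mediator-embed)

      mediator-extendHom : (mediator ∘H extendHom) ≈H h
      mediator-extendHom =
        (λ v → trans (caseFin-extendMap a _ _ (vmap k) v) (sym (caseFin-unique a (vmap h) (λ _ → refl) (proj₁ hg) v))) ,
        (λ e → trans (caseFin-extendMap b _ _ (emap k) e) (sym (caseFin-unique b (emap h) (λ _ → refl) (proj₂ hg) e)))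

    isPushout : IsPushout (embed K X id) k extendHom (embed D X (vmap k))
    isPushout = record
      { commutes = extendMap-↑ʳ a (vmap k) , extendMap-↑ʳ b (emap k)
      ; mediate  = λ Y h g hg → let open Mediator Y h g hg in mediator , mediator-extendHom , mediator-embed
      ; unique   = λ Y w w′ agree-new agree-old →
          split-ext a (λ i → trans (cong (vmap w) (sym (extendMap-↑ˡ a (vmap k) i)))
                               (trans (proj₁ agree-new (i ↑ˡ nodes K)) (cong (vmap w′) (extendMap-↑ˡ a (vmap k) i))))
                      (proj₁ agree-old) ,
          split-ext b (λ i → trans (cong (emap w) (sym (extendMap-↑ˡ b (emap k) i)))
                               (trans (proj₂ agree-new (i ↑ˡ edges K)) (cong (emap w′) (extendMap-↑ˡ b (emap k) i))))
                      (proj₂ agree-old) }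

  extensionRule-step : {K D G : Graph S} (XL XR : Extension (nodes K)) (k : Hom K D) → IsInjective k →
                       G ≅ extend D XL (vmap k) → G ⇒[ extensionRule K XL XR ] extend D XR (vmap k)
  extensionRule-step {K} {D} XL XR k k-inj G≅ =
    (proj₁ φ ∘H PL.extendHom) ,
    ∘H-injective {g = proj₁ φ} {f = PL.extendHom} (≅⇒injective φ) (PL.extendHom-injective k-inj) ,
    D , k , (proj₁ φ ∘H embed D XL (vmap k)) , PR.extendHom , embed D XR (vmap k) ,
    IsPushout-≅ PL.isPushout φ , PR.isPushout
    where
    φ = ≅-sym G≅
    module PL = ExtensionPushout {K} {D} XL k
    module PR = ExtensionPushout {K} {D} XR k

  module Follow (T : ℕ → Graph S) (grow : ∀ m → Hom (T m) (T (suc m))) where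

    Follows : Rule → Set
    Follows ρ = ∀ m (f : Hom (L ρ) (T m)) →
                Σ (Hom (R ρ) (T (suc m))) λ g → (g ∘H r ρ) ≈H (grow m ∘H (f ∘H l ρ))

    -- H is a pushout of R ρ and the context D: the continued match and D → G → T m → T (1 + m)
    -- agree on the interface, since the left square commutes.
    follow-step : ∀ {ρ G H m} → Follows ρ → G ⇒[ ρ ] H → Hom G (T m) → Hom H (T (suc m))
    follow-step {ρ} {m = m} follows (match , _ , D , k , lD , _ , _ , po-l , po-r) φ =
      proj₁ (IsPushout.mediate po-r (T (suc m)) g (grow m ∘H (φ ∘H lD))
               ((λ v → trans (proj₁ g-ok v) (cong (vmap (grow m) ∘ vmap φ) (proj₁ (IsPushout.commutes po-l) v))) ,
                (λ e → trans (proj₂ g-ok e) (cong (emap (grow m) ∘ emap φ) (proj₂ (IsPushout.commutes po-l) e)))))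
      where
      g = proj₁ (follows m (φ ∘H match))
      g-ok = proj₂ (follows m (φ ∘H match))

    follow-derivation : ∀ {rs G H m} → (∀ {ρ} → ρ ∈R rs → Follows ρ) → G ⇒*[ rs ] H → Hom G (T m) →
                        Σ ℕ λ m′ → Hom H (T m′)
    follow-derivation {m = m} _ (done (_ , ψ , _)) φ = m , φ ∘H ψ
    follow-derivation all (step ρ ρ∈ G⇒G′ G′⇒*H) φ =
      follow-derivation all G′⇒*H (follow-step {ρ} (all ρ∈) G⇒G′ φ)

  record FiniteGraph : Set₁ where
    field
      Node Edge     : Set
      #nodes #edges : ℕ
      nodeIndex     : Node ↔ Fin #nodes
      edgeIndex     : Edge ↔ Fin #edges
      endpoint      : End → Edge → Node
      nodeLabel     : Node → Fin (nV S)
      edgeLabel     : Edge → Fin (nE S)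
  open FiniteGraph

  toGraph : FiniteGraph → Graph S
  toGraph F = record
    { nodes = #nodes F ; edges = #edges F
    ; src   = to (nodeIndex F) ∘ endpoint F source ∘ from (edgeIndex F)
    ; tgt   = to (nodeIndex F) ∘ endpoint F target ∘ from (edgeIndex F)
    ; vlab  = nodeLabel F ∘ from (nodeIndex F)
    ; elab  = edgeLabel F ∘ from (edgeIndex F) }

  end-toGraph : ∀ F s e → end s (toGraph F) e ≡ to (nodeIndex F) (endpoint F s (from (edgeIndex F) e))
  end-toGraph F source e = refl
  end-toGraph F target e = refl

  module _ {A : Graph S} (F : FiniteGraph) where

    homInto : (gv : Fin (nodes A) → Node F) (ge : Fin (edges A) → Edge F) →
              (∀ s e → endpoint F s (ge e) ≡ gv (end s A e)) →
              (∀ v → nodeLabel F (gv v) ≡ vlab A v) → (∀ e → edgeLabel F (ge e) ≡ elab A e) → Hom A (toGraph F)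
    homInto gv ge ends-ok vlab-ok′ elab-ok′ = mkHom (to (nodeIndex F) ∘ gv) (to (edgeIndex F) ∘ ge)
      (λ s e → trans (end-toGraph F s _)
                 (cong (to (nodeIndex F)) (trans (cong (endpoint F s) (strictlyInverseʳ (edgeIndex F) (ge e))) (ends-ok s e))))
      (λ v → trans (cong (nodeLabel F) (strictlyInverseʳ (nodeIndex F) (gv v))) (vlab-ok′ v))
      (λ e → trans (cong (edgeLabel F) (strictlyInverseʳ (edgeIndex F) (ge e))) (elab-ok′ e))

    nodeOf : Hom A (toGraph F) → Fin (nodes A) → Node F
    nodeOf f = from (nodeIndex F) ∘ vmap f

    edgeOf : Hom A (toGraph F) → Fin (edges A) → Edge F
    edgeOf f = from (edgeIndex F) ∘ emap f

    nodeOf-end : ∀ (f : Hom A (toGraph F)) s e → endpoint F s (edgeOf f e) ≡ nodeOf f (end s A e)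
    nodeOf-end f s e = trans (sym (strictlyInverseʳ (nodeIndex F) _))
                             (cong (from (nodeIndex F)) (trans (sym (end-toGraph F s (emap f e))) (end-preserved f s e)))

  finiteHom : (F F′ : FiniteGraph) (gv : Node F → Node F′) (ge : Edge F → Edge F′) →
              (∀ s ε → endpoint F′ s (ge ε) ≡ gv (endpoint F s ε)) →
              (∀ x → nodeLabel F′ (gv x) ≡ nodeLabel F x) → (∀ ε → edgeLabel F′ (ge ε) ≡ edgeLabel F ε) →
              Hom (toGraph F) (toGraph F′)
  finiteHom F F′ gv ge ends-ok vlab-ok′ elab-ok′ =
    homInto F′ (gv ∘ from (nodeIndex F)) (ge ∘ from (edgeIndex F))
      (λ s e → trans (ends-ok s _)
                 (cong gv (trans (sym (strictlyInverseʳ (nodeIndex F) _))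
                                 (cong (from (nodeIndex F)) (sym (end-toGraph F s e))))))
      (vlab-ok′ ∘ from (nodeIndex F)) (elab-ok′ ∘ from (edgeIndex F))

  copairInto : ∀ {D : Graph S} {k} (F : FiniteGraph) (X : Extension k) (f : Fin k → Fin (nodes D)) (h : Hom D (toGraph F))
               (nv : Fin (newNodes X) → Node F) (ne : Fin (newEdges X) → Edge F) →
               (∀ s i → endpoint F s (ne i) ≡ [ nv , nodeOf F h ∘ f ]′ (newEnd X s i)) →
               (∀ i → nodeLabel F (nv i) ≡ newVlab X i) → (∀ i → edgeLabel F (ne i) ≡ newElab X i) →
               Σ (Hom (extend D X f) (toGraph F)) λ g → (g ∘H embed D X f) ≈H h
  copairInto F X f h nv ne ends-ok vlab-ok′ elab-ok′ = copair , copair-embed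
    where
    open ≡-Reasoning
    toNode = to (nodeIndex F)
    open Copair X f h (toNode ∘ nv) (to (edgeIndex F) ∘ ne)
      (λ s i → begin
        end s (toGraph F) (to (edgeIndex F) (ne i))
          ≡⟨ end-toGraph F s _ ⟩
        toNode (endpoint F s (from (edgeIndex F) (to (edgeIndex F) (ne i))))
          ≡⟨ cong (toNode ∘ endpoint F s) (strictlyInverseʳ (edgeIndex F) (ne i)) ⟩
        toNode (endpoint F s (ne i))
          ≡⟨ cong toNode (ends-ok s i) ⟩
        toNode ([ nv , nodeOf F h ∘ f ]′ (newEnd X s i))
          ≡⟨ [,]-∘ toNode (newEnd X s i) ⟩
        [ toNode ∘ nv , toNode ∘ nodeOf F h ∘ f ]′ (newEnd X s i)
          ≡⟨ [,]-cong (λ _ → refl) (λ κ → strictlyInverseˡ (nodeIndex F) (vmap h (f κ))) (newEnd X s i) ⟩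
        [ toNode ∘ nv , vmap h ∘ f ]′ (newEnd X s i) ∎)
      (λ i → trans (cong (nodeLabel F) (strictlyInverseʳ (nodeIndex F) (nv i))) (vlab-ok′ i))
      (λ i → trans (cong (edgeLabel F) (strictlyInverseʳ (edgeIndex F) (ne i))) (elab-ok′ i))

fromFin2 : Fin 2 → Reg
fromFin2 zero    = r₀
fromFin2 (suc _) = r₁

toFin2 : Reg → Fin 2
toFin2 r₀ = zero
toFin2 r₁ = suc zero

fromFin2-toFin2 : ∀ r → fromFin2 (toFin2 r) ≡ r
fromFin2-toFin2 r₀ = refl
fromFin2-toFin2 r₁ = refl

toFin2-fromFin2 : ∀ i → toFin2 (fromFin2 i) ≡ i
toFin2-fromFin2 zero       = refl
toFin2-fromFin2 (suc zero) = refl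

Reg↔Fin2 : Reg ↔ Fin 2
Reg↔Fin2 = mk↔ₛ′ toFin2 fromFin2 toFin2-fromFin2 fromFin2-toFin2

_≟ᴿ_ : DecidableEquality Reg
r₀ ≟ᴿ r₀ = yes refl
r₀ ≟ᴿ r₁ = no λ ()
r₁ ≟ᴿ r₀ = no λ ()
r₁ ≟ᴿ r₁ = yes refl

update : ∀ {A : Set} → (Reg → A) → Reg → A → Reg → A
update f r₀ x r₀ = x
update f r₀ x r₁ = f r₁
update f r₁ x r₀ = f r₀
update f r₁ x r₁ = x

update-same : ∀ {A : Set} (f : Reg → A) r x → update f r x r ≡ x
update-same f r₀ x = refl
update-same f r₁ x = refl

update-other : ∀ {A : Set} (f : Reg → A) {r r′} x → r′ ≢ r → update f r x r′ ≡ f r′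
update-other f {r₀} {r₀} x r′≢r = ⊥-elim (r′≢r refl)
update-other f {r₀} {r₁} x _    = refl
update-other f {r₁} {r₀} x _    = refl
update-other f {r₁} {r₁} x r′≢r = ⊥-elim (r′≢r refl)

counter : Reg → Config → ℕ
counter r₀ = Config.c₀
counter r₁ = Config.c₁

setCounter : Reg → ℕ → Config → Config
setCounter r₀ x c = record c { c₀ = x }
setCounter r₁ x c = record c { c₁ = x }

goto : ℕ → Config → Config
goto j c = record c { pc = j }

decrementOrJump : Reg → ℕ → ℕ → Config → ℕ → Config
decrementOrJump r j k c zero    = goto k c
decrementOrJump r j k c (suc x) = goto j (setCounter r x c)

exec : Instr → Config → Config
exec (inc r j)   c = goto j (setCounter r (suc (counter r c)) c)
exec (dec r j k) c = decrementOrJump r j k c (counter r c)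

nth-nothing⇒≤ : ∀ (P : Program) {n} → nth P n ≡ nothing → length P ≤ n
nth-nothing⇒≤ []      eq = z≤n
nth-nothing⇒≤ (_ ∷ P) {zero}  ()
nth-nothing⇒≤ (_ ∷ P) {suc n} eq = s≤s (nth-nothing⇒≤ P eq)

nth-just⇒< : ∀ (P : Program) {n i} → nth P n ≡ just i → n < length P
nth-just⇒< []      ()
nth-just⇒< (_ ∷ P) {zero}  eq = s≤s z≤n
nth-just⇒< (_ ∷ P) {suc n} eq = s≤s (nth-just⇒< P eq)

≤⇒nth-nothing : ∀ (P : Program) {n} → length P ≤ n → nth P n ≡ nothing
≤⇒nth-nothing []      _       = refl
≤⇒nth-nothing (_ ∷ P) (s≤s h) = ≤⇒nth-nothing P h

counter-goto : ∀ r j c → counter r (goto j c) ≡ counter r c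
counter-goto r₀ j c = refl
counter-goto r₁ j c = refl

counter-setCounter-same : ∀ r x c → counter r (setCounter r x c) ≡ x
counter-setCounter-same r₀ x c = refl
counter-setCounter-same r₁ x c = refl

counter-setCounter-other : ∀ {r r′} x c → r′ ≢ r → counter r′ (setCounter r x c) ≡ counter r′ c
counter-setCounter-other {r₀} {r₀} x c r′≢r = ⊥-elim (r′≢r refl)
counter-setCounter-other {r₀} {r₁} x c _    = refl
counter-setCounter-other {r₁} {r₀} x c _    = refl
counter-setCounter-other {r₁} {r₁} x c r′≢r = ⊥-elim (r′≢r refl)

counter-setCounter-≤ : ∀ r r′ {x} c → x ≤ suc (counter r′ c) → counter r (setCounter r′ x c) ≤ suc (counter r c)
counter-setCounter-≤ r₀ r₀ c x≤ = x≤
counter-setCounter-≤ r₀ r₁ c _  = n≤1+n _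
counter-setCounter-≤ r₁ r₀ c _  = n≤1+n _
counter-setCounter-≤ r₁ r₁ c x≤ = x≤

exec-counter-≤ : ∀ i c r → counter r (exec i c) ≤ suc (counter r c)
exec-counter-≤ (inc r′ j) c r =
  subst (_≤ suc (counter r c)) (sym (counter-goto r j _)) (counter-setCounter-≤ r r′ c ≤-refl)
exec-counter-≤ (dec r′ j k) c r = decrementOrJump-≤ (counter r′ c) refl
  where
  decrementOrJump-≤ : ∀ n → counter r′ c ≡ n → counter r (decrementOrJump r′ j k c n) ≤ suc (counter r c)
  decrementOrJump-≤ zero    _  = subst (_≤ suc (counter r c)) (sym (counter-goto r k c)) (n≤1+n _)
  decrementOrJump-≤ (suc n) eq = subst (_≤ suc (counter r c)) (sym (counter-goto r j _))
    (counter-setCounter-≤ r r′ c (≤-trans (n≤1+n n) (subst (_≤ suc (counter r′ c)) eq (n≤1+n _))))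

exec-dec-zero : ∀ {r j k c} → counter r c ≡ 0 → exec (dec r j k) c ≡ goto k c
exec-dec-zero {r} {j} {k} {c} eq rewrite eq = refl

exec-dec-suc : ∀ {r j k c n} → counter r c ≡ suc n → exec (dec r j k) c ≡ goto j (setCounter r n c)
exec-dec-suc {r} {j} {k} {c} eq rewrite eq = refl

module _ (P : Program) where

  stepCM-exec : ∀ c {i} → nth P (Config.pc c) ≡ just i → stepCM P c ≡ just (exec i c)
  stepCM-exec c eq with nth P (Config.pc c)
  stepCM-exec c refl | just (inc r₀ j)   = refl
  stepCM-exec c refl | just (inc r₁ j)   = refl
  stepCM-exec ⟨ p , zero  , b ⟩ refl | just (dec r₀ j k) = refl
  stepCM-exec ⟨ p , suc a , b ⟩ refl | just (dec r₀ j k) = refl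
  stepCM-exec ⟨ p , a , zero  ⟩ refl | just (dec r₁ j k) = refl
  stepCM-exec ⟨ p , a , suc b ⟩ refl | just (dec r₁ j k) = refl

  stepCM-halt : ∀ c → nth P (Config.pc c) ≡ nothing → stepCM P c ≡ nothing
  stepCM-halt c eq with nth P (Config.pc c)
  stepCM-halt c refl | nothing = refl

  runCM-step : ∀ n c {c′} → stepCM P c ≡ just c′ → runCM P (suc n) c ≡ runCM P n c′
  runCM-step n c eq with stepCM P c
  runCM-step n c refl | just _ = refl

  runCM-halt : ∀ n c → stepCM P c ≡ nothing → runCM P (suc n) c ≡ nothing
  runCM-halt n c eq with stepCM P c
  runCM-halt n c refl | nothing = refl

  next : Config → Config
  next c = maybe′ (λ i → exec i c) c (nth P (Config.pc c))

  run : ℕ → Config → Config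
  run zero    c = c
  run (suc n) c = run n (next c)

  run-suc : ∀ n c → run (suc n) c ≡ next (run n c)
  run-suc zero    c = refl
  run-suc (suc n) c = run-suc n (next c)

  run-exit : ∀ n c → length P ≤ Config.pc (run n c) → runCM P (suc n) c ≡ nothing
  run-exit zero    c exit = runCM-halt 0 c (stepCM-halt c (≤⇒nth-nothing P exit))
  run-exit (suc n) c exit = continue (nth P (Config.pc c)) refl exit
    where
    continue : ∀ m → nth P (Config.pc c) ≡ m →
               length P ≤ Config.pc (run n (maybe′ (λ i → exec i c) c m)) → runCM P (suc (suc n)) c ≡ nothing
    continue nothing  eq _    = runCM-halt (suc n) c (stepCM-halt c eq)
    continue (just i) eq exit = trans (runCM-step (suc n) c (stepCM-exec c eq)) (run-exit n (exec i c) exit)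

  trace : ℕ → Config
  trace n = run n ⟨ 0 , 0 , 0 ⟩

  trace-suc : ∀ n {i} → nth P (Config.pc (trace n)) ≡ just i → trace (suc n) ≡ exec i (trace n)
  trace-suc n eq = trans (run-suc n ⟨ 0 , 0 , 0 ⟩) (cong (maybe′ (λ i → exec i (trace n)) (trace n)) eq)

  trace-exit⇒halts : ∀ n → length P ≤ Config.pc (trace n) → Halts P
  trace-exit⇒halts n exit = suc n , run-exit n ⟨ 0 , 0 , 0 ⟩ exit

  counter-next-≤ : ∀ r c → counter r (next c) ≤ suc (counter r c)
  counter-next-≤ r c with nth P (Config.pc c)
  ... | nothing = n≤1+n _
  ... | just i  = exec-counter-≤ i c r

  counter-trace-≤ : ∀ n r → counter r (trace n) ≤ n
  counter-trace-≤ zero    r₀ = z≤n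
  counter-trace-≤ zero    r₁ = z≤n
  counter-trace-≤ (suc n) r  rewrite run-suc n ⟨ 0 , 0 , 0 ⟩ =
    ≤-trans (counter-next-≤ r (trace n)) (s≤s (counter-trace-≤ n r))

module Encoding (P : Program) where

  signature : Signature
  signature = record { nV = 3 + length P ; nE = 4 }

  VLabel ELabel : Set
  VLabel = Fin (nV signature)
  ELabel = Fin (nE signature)

  counterLabel : Reg → VLabel
  counterLabel r₀ = zero
  counterLabel r₁ = suc zero

  haltLabel : VLabel
  haltLabel = suc (suc zero)

  stateLabel : ℕ → VLabel
  stateLabel q with q <? length P
  ... | yes q<len = suc (suc (suc (fromℕ< q<len)))
  ... | no  _     = haltLabel

  nonTerminal : VLabel → Bool
  nonTerminal (suc (suc (suc _))) = true
  nonTerminal _                   = false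

  succLabel zeroLabel : ELabel
  succLabel = zero
  zeroLabel = suc zero

  pointerLabel : Reg → ELabel
  pointerLabel r₀ = suc (suc zero)
  pointerLabel r₁ = suc (suc (suc zero))

  counterLabel-injective : ∀ {r r′} → counterLabel r ≡ counterLabel r′ → r ≡ r′
  counterLabel-injective {r₀} {r₀} _ = refl
  counterLabel-injective {r₁} {r₁} _ = refl
  counterLabel-injective {r₀} {r₁} ()
  counterLabel-injective {r₁} {r₀} ()

  pointerLabel-injective : ∀ {r r′} → pointerLabel r ≡ pointerLabel r′ → r ≡ r′
  pointerLabel-injective {r₀} {r₀} _ = refl
  pointerLabel-injective {r₁} {r₁} _ = refl
  pointerLabel-injective {r₀} {r₁} ()
  pointerLabel-injective {r₁} {r₀} ()

  counterLabel-terminal : ∀ r → nonTerminal (counterLabel r) ≡ false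
  counterLabel-terminal r₀ = refl
  counterLabel-terminal r₁ = refl

  stateLabel-halt : ∀ {q} → length P ≤ q → stateLabel q ≡ haltLabel
  stateLabel-halt {q} len≤q with q <? length P
  ... | yes q<len = ⊥-elim (<⇒≱ q<len len≤q)
  ... | no  _     = refl

  stateLabel-halt⁻¹ : ∀ {q} → stateLabel q ≡ haltLabel → length P ≤ q
  stateLabel-halt⁻¹ {q} eq with q <? length P
  stateLabel-halt⁻¹ () | yes _
  ... | no q≮len = ≮⇒≥ q≮len

  stateLabel-injective : ∀ {n q} → q < length P → stateLabel n ≡ stateLabel q → n ≡ q
  stateLabel-injective {n} {q} q<len eq with n <? length P | q <? length P
  ... | _         | no q≮len  = ⊥-elim (q≮len q<len)
  ... | yes n<len | yes q<len′ =
    trans (sym (toℕ-fromℕ< n<len))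
          (trans (cong toℕ (suc-injective (suc-injective (suc-injective eq)))) (toℕ-fromℕ< q<len′))
  ... | no _      | yes _ with eq
  ... | ()

  open Extension

  control : ∀ {k} → ℕ → (Reg → Fin k) → Extension {signature} k
  control q position = record
    { newNodes = 1 ; newEdges = 2
    ; newVlab  = λ _ → stateLabel q
    ; newElab  = pointerLabel ∘ fromFin2
    ; newSrc   = λ _ → inj₁ zero
    ; newTgt   = inj₂ ∘ position ∘ fromFin2 }

  -- Where the pointer of register r′ ends after incrementing r:
  -- at the new counter node (new node 1) if r′ = r, at the old position otherwise.
  incrementedPosition : Reg → Reg → Fin 2 ⊎ Fin 2
  incrementedPosition r₀ r₀ = inj₁ (suc zero)
  incrementedPosition r₀ r₁ = inj₂ (toFin2 r₁)
  incrementedPosition r₁ r₀ = inj₂ (toFin2 r₀)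
  incrementedPosition r₁ r₁ = inj₁ (suc zero)

  incrementedPosition-same : ∀ r → incrementedPosition r r ≡ inj₁ (suc zero)
  incrementedPosition-same r₀ = refl
  incrementedPosition-same r₁ = refl

  incrementedPosition-other : ∀ {r r′} → r′ ≢ r → incrementedPosition r r′ ≡ inj₂ (toFin2 r′)
  incrementedPosition-other {r₀} {r₀} r′≢r = ⊥-elim (r′≢r refl)
  incrementedPosition-other {r₀} {r₁} _    = refl
  incrementedPosition-other {r₁} {r₀} _    = refl
  incrementedPosition-other {r₁} {r₁} r′≢r = ⊥-elim (r′≢r refl)

  increment : Reg → ℕ → Extension {signature} 2
  increment r j = record
    { newNodes = 2 ; newEdges = 3
    ; newVlab  = λ { zero → stateLabel j ; (suc _) → counterLabel r }
    ; newElab  = λ { zero → pointerLabel r₀ ; (suc zero) → pointerLabel r₁ ; (suc (suc _)) → succLabel }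
    ; newSrc   = λ { (suc (suc _)) → inj₂ (toFin2 r) ; _ → inj₁ zero }
    ; newTgt   = λ { zero → incrementedPosition r r₀ ; (suc zero) → incrementedPosition r r₁
                   ; (suc (suc _)) → inj₁ (suc zero) } }

  counterPositions : Graph signature
  counterPositions = record
    { nodes = 2 ; edges = 0 ; src = λ () ; tgt = λ () ; vlab = counterLabel ∘ fromFin2 ; elab = λ () }

  zeroLoopAt : Reg → Graph signature
  zeroLoopAt r = record
    { nodes = 2 ; edges = 1 ; src = λ _ → toFin2 r ; tgt = λ _ → toFin2 r
    ; vlab = counterLabel ∘ fromFin2 ; elab = λ _ → zeroLabel }

  -- Node 0 is the predecessor of the position of r (nodes 1 and 2 are the positions).
  predecessorOf : Reg → Graph signature
  predecessorOf r = record
    { nodes = 3 ; edges = 1 ; src = λ _ → zero ; tgt = λ _ → suc (toFin2 r)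
    ; vlab = λ { zero → counterLabel r ; (suc κ) → counterLabel (fromFin2 κ) } ; elab = λ _ → succLabel }

  incrementRule decrementRule zeroTestRule : ℕ → Reg → ℕ → Rule
  incrementRule q r j = extensionRule counterPositions (control q toFin2) (increment r j)
  decrementRule q r j = extensionRule (predecessorOf r) (control q (suc ∘ toFin2))
                                      (control j (update (suc ∘ toFin2) r zero))
  zeroTestRule  q r k = extensionRule (zeroLoopAt r) (control q toFin2) (control k toFin2)

  rulesFor : ℕ → Instr → List Rule
  rulesFor q (inc r j)   = incrementRule q r j ∷ []
  rulesFor q (dec r j k) = decrementRule q r j ∷ zeroTestRule q r k ∷ []

  rulesFrom : ℕ → Program → List Rule
  rulesFrom q []       = []
  rulesFrom q (i ∷ is) = rulesFor q i ++ rulesFrom (suc q) is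

  rulesFor⊆rulesFrom : ∀ {ρ} q is {n i} → nth is n ≡ just i → ρ ∈ rulesFor (q + n) i → ρ ∈ rulesFrom q is
  rulesFor⊆rulesFrom {ρ} q (i ∷ is)  {zero}  refl ρ∈ =
    ∈-++⁺ˡ (subst (λ q′ → ρ ∈ rulesFor q′ i) (+-identityʳ q) ρ∈)
  rulesFor⊆rulesFrom {ρ} q (i′ ∷ is) {suc n} {i} eq ρ∈ =
    ∈-++⁺ʳ (rulesFor q i′)
           (rulesFor⊆rulesFrom (suc q) is eq (subst (λ q′ → ρ ∈ rulesFor q′ i) (+-suc q n) ρ∈))

  rulesFrom⊆rulesFor : ∀ {ρ} q is → ρ ∈ rulesFrom q is →
                       Σ ℕ λ n → Σ Instr λ i → nth is n ≡ just i × ρ ∈ rulesFor (q + n) i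
  rulesFrom⊆rulesFor {ρ} q (i ∷ is) ρ∈ with ∈-++⁻ (rulesFor q i) ρ∈
  ... | inj₁ ρ∈i = 0 , i , refl , subst (λ q′ → ρ ∈ rulesFor q′ i) (sym (+-identityʳ q)) ρ∈i
  ... | inj₂ ρ∈is with rulesFrom⊆rulesFor (suc q) is ρ∈is
  ... | n , i′ , eq , ρ∈′ = suc n , i′ , eq , subst (λ q′ → ρ ∈ rulesFor q′ i′) (sym (+-suc q n)) ρ∈′

  configurationGraph : (D : Graph signature) → (Reg → Fin (nodes D)) → ℕ → Graph signature
  configurationGraph D position q = extend D (control q toFin2) (position ∘ fromFin2)

  initialCounters : Graph signature
  initialCounters = record
    { nodes = 2 ; edges = 2 ; src = id ; tgt = id ; vlab = counterLabel ∘ fromFin2 ; elab = λ _ → zeroLabel }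

  grammar : Grammar signature
  grammar = record
    { NV = nonTerminal ; NE = λ _ → false
    ; rules = rulesFrom 0 P ; start = configurationGraph initialCounters toFin2 0 }

  haltNode : Graph signature
  haltNode = record { nodes = 1 ; edges = 0 ; src = λ () ; tgt = λ () ; vlab = λ _ → haltLabel ; elab = λ () }

-- Completeness: a halting run is derivable

module Completeness (P : Program) where

  open Encoding P

  data Chain (D : Graph signature) (r : Reg) : ℕ → Fin (nodes D) → Set where
    base : ∀ {y} e → src D e ≡ y → tgt D e ≡ y → elab D e ≡ zeroLabel → vlab D y ≡ counterLabel r →
           Chain D r 0 y
    cons : ∀ {n x y} → Chain D r n x → ∀ e → src D e ≡ x → tgt D e ≡ y → elab D e ≡ succLabel →
           vlab D y ≡ counterLabel r → Chain D r (suc n) y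

  Chain-label : ∀ {D r n y} → Chain D r n y → vlab D y ≡ counterLabel r
  Chain-label (base _ _ _ _ ly)   = ly
  Chain-label (cons _ _ _ _ _ ly) = ly

  Chain-map : ∀ {D D′ r n y} (h : Hom D D′) → Chain D r n y → Chain D′ r n (vmap h y)
  Chain-map h (base e se te le ly) =
    base (emap h e) (trans (src-ok h e) (cong (vmap h) se)) (trans (tgt-ok h e) (cong (vmap h) te))
         (trans (elab-ok h e) le) (trans (vlab-ok h _) ly)
  Chain-map h (cons ch e se te le ly) =
    cons (Chain-map h ch) (emap h e) (trans (src-ok h e) (cong (vmap h) se))
         (trans (tgt-ok h e) (cong (vmap h) te)) (trans (elab-ok h e) le) (trans (vlab-ok h _) ly)

  record Chains (D : Graph signature) (position : Reg → Fin (nodes D)) (n₀ n₁ : ℕ) : Set where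
    constructor chains
    field
      chain₀ : Chain D r₀ n₀ (position r₀)
      chain₁ : Chain D r₁ n₁ (position r₁)

  ChainsFor : (D : Graph signature) → (Reg → Fin (nodes D)) → Config → Set
  ChainsFor D position c = Chains D position (Config.c₀ c) (Config.c₁ c)

  chainOf : ∀ {D position} c → ChainsFor D position c → ∀ r → Chain D r (counter r c) (position r)
  chainOf c (chains ch₀ _) r₀ = ch₀
  chainOf c (chains _ ch₁) r₁ = ch₁

  Chains-map : ∀ {D D′ position n₀ n₁} (h : Hom D D′) →
               Chains D position n₀ n₁ → Chains D′ (vmap h ∘ position) n₀ n₁
  Chains-map h (chains ch₀ ch₁) = chains (Chain-map h ch₀) (Chain-map h ch₁)

  Chains-update : ∀ {D n y} {position : Reg → Fin (nodes D)} c r → Chain D r n y → ChainsFor D position c →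
                  ChainsFor D (update position r y) (setCounter r n c)
  Chains-update c r₀ new (chains _ ch₁) = chains new ch₁
  Chains-update c r₁ new (chains ch₀ _) = chains ch₀ new

  -- The absence of succ-loops keeps the matches of the decrement rules injective.
  WellFormed : Graph signature → Set
  WellFormed D = (∀ v → nonTerminal (vlab D v) ≡ false) × (∀ e → elab D e ≡ succLabel → src D e ≢ tgt D e)

  record Represents (G : Graph signature) (c : Config) : Set where
    field
      counters   : Graph signature
      wellFormed : WellFormed counters
      position   : Reg → Fin (nodes counters)
      chained    : ChainsFor counters position c
      shape      : G ≅ configurationGraph counters position (Config.pc c)

    position-label : ∀ r → vlab counters (position r) ≡ counterLabel r
    position-label r = Chain-label (chainOf c chained r)

    position-injective : ∀ {r r′} → position r ≡ position r′ → r ≡ r′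
    position-injective {r} {r′} eq =
      counterLabel-injective (trans (sym (position-label r)) (trans (cong (vlab counters) eq) (position-label r′)))

    positions-injective : Injective _≡_ _≡_ (position ∘ fromFin2)
    positions-injective {zero}     {zero}     _  = refl
    positions-injective {suc zero} {suc zero} _  = refl
    positions-injective {zero}     {suc zero} eq with position-injective eq
    ... | ()
    positions-injective {suc zero} {zero}     eq with position-injective eq
    ... | ()
  open Represents

  Step : Graph signature → Config → Set₁
  Step G c′ = Σ (Graph signature) λ G′ → Σ Rule λ ρ → ρ ∈ rulesFrom 0 P × G ⇒[ ρ ] G′ × Represents G′ c′

  matchPositions : ∀ {G c} (rep : Represents G c) → Hom counterPositions (counters rep)
  matchPositions rep = record
    { vmap = position rep ∘ fromFin2 ; emap = λ () ; src-ok = λ () ; tgt-ok = λ ()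
    ; vlab-ok = position-label rep ∘ fromFin2 ; elab-ok = λ () }

  successor : Reg → Extension {signature} 1
  successor r = record
    { newNodes = 1 ; newEdges = 1 ; newVlab = λ _ → counterLabel r ; newElab = λ _ → succLabel
    ; newSrc = λ _ → inj₂ zero ; newTgt = λ _ → inj₁ zero }

  WellFormed-successor : ∀ {D} r (y : Fin (nodes D)) → WellFormed D → WellFormed (extend D (successor r) (λ _ → y))
  WellFormed-successor r y (terminal , noLoop) =
    (λ { zero → counterLabel-terminal r ; (suc v) → terminal v }) ,
    (λ { zero _ () ; (suc e) isSucc eq → noLoop e isSucc (suc-injective eq) })

  incrementedPosition-attach : ∀ {n} (position : Reg → Fin n) r r′ →
    attach 2 (position ∘ fromFin2) (incrementedPosition r r′) ≡ 1 ↑ʳ update ((1 ↑ʳ_) ∘ position) r zero r′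
  incrementedPosition-attach position r₀ r₀ = refl
  incrementedPosition-attach position r₀ r₁ = refl
  incrementedPosition-attach position r₁ r₀ = refl
  incrementedPosition-attach position r₁ r₁ = refl

  increment-≅ : ∀ {D} r j (position : Reg → Fin (nodes D)) →
                extend D (increment r j) (position ∘ fromFin2) ≅
                configurationGraph (extend D (successor r) (λ _ → position r)) (update ((1 ↑ʳ_) ∘ position) r zero) j
  increment-≅ r j position = ≅-pointwise
    (λ { zero → refl ; (suc zero) → refl
       ; (suc (suc zero)) → cong (λ r′ → 2 ↑ʳ position r′) (fromFin2-toFin2 r) ; (suc (suc (suc _))) → refl })
    (λ { zero → incrementedPosition-attach position r r₀ ; (suc zero) → incrementedPosition-attach position r r₁
       ; (suc (suc zero)) → refl ; (suc (suc (suc _))) → refl })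
    (λ { zero → refl ; (suc zero) → refl ; (suc (suc _)) → refl })
    (λ { zero → refl ; (suc zero) → refl ; (suc (suc zero)) → refl ; (suc (suc (suc _))) → refl })

  incrementStep : ∀ {G c r j} → Represents G c → nth P (Config.pc c) ≡ just (inc r j) → Step G (exec (inc r j) c)
  incrementStep {c = c} {r} {j} rep eq =
    extend D (increment r j) (position rep ∘ fromFin2) , incrementRule (Config.pc c) r j ,
    rulesFor⊆rulesFrom 0 P eq (here refl) ,
    extensionRule-step (control (Config.pc c) toFin2) (increment r j) (matchPositions rep)
                       (positions-injective rep , λ { {()} }) (shape rep) ,
    record
      { counters   = extend D (successor r) (λ _ → position rep r)
      ; wellFormed = WellFormed-successor r (position rep r) (wellFormed rep)
      ; position   = update ((1 ↑ʳ_) ∘ position rep) r zero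
      ; chained    = Chains-update c r (cons (Chain-map ι (chainOf c (chained rep) r)) zero refl refl refl refl)
                                     (Chains-map ι (chained rep))
      ; shape      = increment-≅ r j (position rep) }
    where
    D = counters rep
    ι = embed D (successor r) (λ _ → position rep r)

  predecessorMap : ∀ {n} → Fin n → (Reg → Fin n) → Fin 3 → Fin n
  predecessorMap x position zero    = x
  predecessorMap x position (suc κ) = position (fromFin2 κ)

  predecessorMap-update : ∀ {n} (x : Fin n) (position : Reg → Fin n) r r′ →
                          predecessorMap x position (update (suc ∘ toFin2) r zero r′) ≡ update position r x r′
  predecessorMap-update x position r₀ r₀ = refl
  predecessorMap-update x position r₀ r₁ = refl
  predecessorMap-update x position r₁ r₀ = refl
  predecessorMap-update x position r₁ r₁ = refl

  decrement-≅ : ∀ {D} r j x (position : Reg → Fin (nodes D)) →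
                extend D (control j (update (suc ∘ toFin2) r zero)) (predecessorMap x position) ≅
                configurationGraph D (update position r x) j
  decrement-≅ r j x position = ≅-pointwise
    (λ _ → refl)
    (λ { zero → cong (1 ↑ʳ_) (predecessorMap-update x position r r₀)
       ; (suc zero) → cong (1 ↑ʳ_) (predecessorMap-update x position r r₁) ; (suc (suc _)) → refl })
    (λ _ → refl) (λ _ → refl)

  module _ {G c} (rep : Represents G c) where

    private
      D = counters rep

    matchZeroLoop : ∀ r e → src D e ≡ position rep r → tgt D e ≡ position rep r → elab D e ≡ zeroLabel →
                    Σ (Hom (zeroLoopAt r) D) IsInjective
    matchZeroLoop r e se te le =
      record { vmap = position rep ∘ fromFin2 ; emap = λ _ → e
             ; src-ok = λ _ → trans se (cong (position rep) (sym (fromFin2-toFin2 r)))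
             ; tgt-ok = λ _ → trans te (cong (position rep) (sym (fromFin2-toFin2 r)))
             ; vlab-ok = position-label rep ∘ fromFin2 ; elab-ok = λ _ → le } ,
      positions-injective rep , λ { {zero} {zero} _ → refl }

    matchPredecessor : ∀ r x → vlab D x ≡ counterLabel r → ∀ e → src D e ≡ x → tgt D e ≡ position rep r →
                       elab D e ≡ succLabel → Σ (Hom (predecessorOf r) D) IsInjective
    matchPredecessor r x lx e se te le =
      record { vmap = predecessorMap x (position rep) ; emap = λ _ → e
             ; src-ok = λ _ → se
             ; tgt-ok = λ _ → trans te (cong (position rep) (sym (fromFin2-toFin2 r)))
             ; vlab-ok = λ { zero → lx ; (suc κ) → position-label rep (fromFin2 κ) } ; elab-ok = λ _ → le } ,
      vmap-injective , λ { {zero} {zero} _ → refl }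
      where
      x≢position : ∀ r′ → x ≢ position rep r′
      x≢position r′ eq with r′ ≟ᴿ r
      ... | yes refl = proj₂ (wellFormed rep) e le (trans se (trans eq (sym te)))
      ... | no r′≢r  = r′≢r (counterLabel-injective
                               (trans (sym (position-label rep r′)) (trans (cong (vlab D) (sym eq)) lx)))
      vmap-injective : Injective _≡_ _≡_ (predecessorMap x (position rep))
      vmap-injective {zero}  {zero}   _  = refl
      vmap-injective {zero}  {suc κ}  eq = ⊥-elim (x≢position (fromFin2 κ) eq)
      vmap-injective {suc κ} {zero}   eq = ⊥-elim (x≢position (fromFin2 κ) (sym eq))
      vmap-injective {suc κ} {suc κ′} eq = cong suc (positions-injective rep eq)

  decrementStep : ∀ {G c r j k} → Represents G c → nth P (Config.pc c) ≡ just (dec r j k) →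
                  Step G (decrementOrJump r j k c (counter r c))
  decrementStep {G} {c} {r} {j} {k} rep eq with counter r c | chainOf c (chained rep) r
  ... | zero  | base e se te le _ =
    configurationGraph (counters rep) (position rep) k , zeroTestRule (Config.pc c) r k ,
    rulesFor⊆rulesFrom 0 P eq (there (here refl)) ,
    extensionRule-step (control (Config.pc c) toFin2) (control k toFin2) (proj₁ match) (proj₂ match) (shape rep) ,
    record { counters = counters rep ; wellFormed = wellFormed rep ; position = position rep
           ; chained = chained rep ; shape = ≅-refl }
    where match = matchZeroLoop rep r e se te le
  ... | suc n | cons {x = x} ch e se te le _ =
    extend (counters rep) (control j (update (suc ∘ toFin2) r zero)) (vmap (proj₁ match)) ,
    decrementRule (Config.pc c) r j , rulesFor⊆rulesFrom 0 P eq (here refl) ,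
    extensionRule-step (control (Config.pc c) (suc ∘ toFin2)) (control j (update (suc ∘ toFin2) r zero))
                       (proj₁ match) (proj₂ match) (shape rep) ,
    record { counters = counters rep ; wellFormed = wellFormed rep ; position = update (position rep) r x
           ; chained = Chains-update c r ch (chained rep) ; shape = decrement-≅ r j x (position rep) }
    where match = matchPredecessor rep r x (Chain-label ch) e se te le

  simulate : ∀ {G c} i → Represents G c → nth P (Config.pc c) ≡ just i → Step G (exec i c)
  simulate (inc r j)   = incrementStep
  simulate (dec r j k) = decrementStep

  halted : ∀ {G c} → Represents G c → length P ≤ Config.pc c →
           TerminallyLabelled grammar G × Σ (Hom haltNode G) IsInjective
  halted {G} {c} rep exit =
    ((λ v → trans (cong nonTerminal (sym (vlab-ok φ v))) (terminal (vmap φ v))) , (λ _ → refl)) ,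
    record { vmap = λ _ → vmap ψ zero ; emap = λ () ; src-ok = λ () ; tgt-ok = λ ()
           ; vlab-ok = λ _ → trans (vlab-ok ψ zero) (stateLabel-halt exit) ; elab-ok = λ () } ,
    (λ { {zero} {zero} _ → refl }) , λ { {()} }
    where
    D = counters rep
    φ = proj₁ (shape rep)
    ψ = proj₁ (proj₂ (shape rep))
    terminal : ∀ w → nonTerminal (vlab (configurationGraph D (position rep) (Config.pc c)) w) ≡ false
    terminal w with splitView 1 (nodes D) w
    ... | left zero = cong nonTerminal (stateLabel-halt exit)
    ... | right v   = proj₁ (wellFormed rep) v

  Reaches : Graph signature → Set₁
  Reaches G = Σ (Graph signature) λ H → G ⇒*[ rulesFrom 0 P ] H ×
              TerminallyLabelled grammar H × Σ (Hom haltNode H) IsInjective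

  reaches : ∀ n c {G} → Represents G c → runCM P n c ≡ nothing → Reaches G
  reaches (suc n) c {G} rep halts = continue (nth P (Config.pc c)) refl
    where
    continue : ∀ m → nth P (Config.pc c) ≡ m → Reaches G
    continue nothing  eq = G , done ≅-refl , halted rep (nth-nothing⇒≤ P eq)
    continue (just i) eq =
      let (G′ , ρ , ρ∈ , G⇒G′ , rep′) = simulate i rep eq
          (H , G′⇒*H , reached) = reaches n (exec i c) rep′
                                    (trans (sym (runCM-step P n c (stepCM-exec P c eq))) halts)
      in H , step ρ (∈⇒∈R ρ∈) G⇒G′ G′⇒*H , reached

  initial : Represents (start grammar) ⟨ 0 , 0 , 0 ⟩
  initial = record
    { counters   = initialCounters
    ; wellFormed = (counterLabel-terminal ∘ fromFin2) , (λ { zero () ; (suc zero) () })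
    ; position   = toFin2
    ; chained    = chains (base zero refl refl refl refl) (base (suc zero) refl refl refl refl)
    ; shape      = ≅-refl }

  completeness : Halts P → SubgraphClosure (InLang grammar) haltNode
  completeness (n , halts) =
    let (H , derivation , terminal , embedding) = reaches n ⟨ 0 , 0 , 0 ⟩ initial halts
    in H , (derivation , terminal) , embedding

-- Soundness: derived graphs follow the run

module Soundness (P : Program) where

  open Encoding P
  open Extension
  open FiniteGraph

  -- Register r at time i ≤ m; it fits in Fin (1 + m) since a step raises a counter by at most one.
  counterAt : ∀ {m} → Fin (suc m) → Reg → Fin (suc m)
  counterAt i r = fromℕ< (s≤s (≤-trans (counter-trace-≤ P (toℕ i) r) (toℕ≤pred[n] i)))

  counterAt-≡ : ∀ {m} (i : Fin (suc m)) r {y} → toℕ y ≡ counter r (trace P (toℕ i)) → counterAt i r ≡ y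
  counterAt-≡ i r eq = toℕ-injective (trans (toℕ-fromℕ< _) (sym eq))

  counterAt-inject₁ : ∀ {m} (i : Fin (suc m)) r → counterAt (inject₁ i) r ≡ inject₁ (counterAt i r)
  counterAt-inject₁ i r = counterAt-≡ (inject₁ i) r
    (trans (toℕ-inject₁ _) (trans (toℕ-fromℕ< _) (cong (λ n → counter r (trace P n)) (sym (toℕ-inject₁ i)))))

  -- Nodes: the position x of register r, and the control node at time i.
  -- Edges: succ-edges x → x + 1 and the zero loop at 0 of each register, and the pointers at time i.
  TraceNode TraceEdge : ℕ → Set
  TraceNode m = (Reg × Fin (suc m)) ⊎ Fin (suc m)
  TraceEdge m = Reg × (Fin m ⊎ (⊤ ⊎ Fin (suc m)))

  pattern positionN r x  = inj₁ (r , x)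
  pattern controlN i     = inj₂ i
  pattern succE r x      = r , inj₁ x
  pattern zeroE r        = r , inj₂ (inj₁ tt)
  pattern pointerE r i   = r , inj₂ (inj₂ i)

  traceEnd : ∀ {m} → End → TraceEdge m → TraceNode m
  traceEnd source (succE r x)    = positionN r (inject₁ x)
  traceEnd target (succE r x)    = positionN r (suc x)
  traceEnd _      (zeroE r)      = positionN r zero
  traceEnd source (pointerE r i) = controlN i
  traceEnd target (pointerE r i) = positionN r (counterAt i r)

  traceNodeLabel : ∀ {m} → TraceNode m → VLabel
  traceNodeLabel (positionN r _) = counterLabel r
  traceNodeLabel (controlN i)    = stateLabel (Config.pc (trace P (toℕ i)))

  traceEdgeLabel : ∀ {m} → TraceEdge m → ELabel
  traceEdgeLabel (succE _ _)    = succLabel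
  traceEdgeLabel (zeroE _)      = zeroLabel
  traceEdgeLabel (pointerE r _) = pointerLabel r

  traceGraph : ℕ → FiniteGraph {signature}
  traceGraph m = record
    { Node = TraceNode m ; Edge = TraceEdge m
    ; #nodes = 2 * suc m + suc m ; #edges = 2 * (m + (1 + suc m))
    ; nodeIndex = ↔-sym (↔-trans +↔⊎ (↔-trans *↔× (↔-sym Reg↔Fin2 ×-↔ ↔-refl) ⊎-↔ ↔-refl))
    ; edgeIndex = ↔-sym (↔-trans *↔× (↔-sym Reg↔Fin2 ×-↔
                                       ↔-trans +↔⊎ (↔-refl ⊎-↔ ↔-trans +↔⊎ (1↔⊤ ⊎-↔ ↔-refl))))
    ; endpoint = traceEnd ; nodeLabel = traceNodeLabel ; edgeLabel = traceEdgeLabel }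

  T : ℕ → Graph signature
  T m = toGraph (traceGraph m)

  growNode : ∀ {m} → TraceNode m → TraceNode (suc m)
  growNode (positionN r x) = positionN r (inject₁ x)
  growNode (controlN i)    = controlN (inject₁ i)

  growEdge : ∀ {m} → TraceEdge m → TraceEdge (suc m)
  growEdge (succE r x)    = succE r (inject₁ x)
  growEdge (zeroE r)      = zeroE r
  growEdge (pointerE r i) = pointerE r (inject₁ i)

  grow : ∀ m → Hom (T m) (T (suc m))
  grow m = finiteHom (traceGraph m) (traceGraph (suc m)) growNode growEdge ends-ok vlab-ok′
                     (λ { (succE _ _) → refl ; (zeroE _) → refl ; (pointerE _ _) → refl })
    where
    ends-ok : ∀ s ε → traceEnd s (growEdge ε) ≡ growNode (traceEnd s ε)
    ends-ok source (succE r x)    = refl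
    ends-ok target (succE r x)    = refl
    ends-ok source (zeroE r)      = refl
    ends-ok target (zeroE r)      = refl
    ends-ok source (pointerE r i) = refl
    ends-ok target (pointerE r i) = cong (positionN r) (counterAt-inject₁ i r)
    vlab-ok′ : ∀ x → traceNodeLabel (growNode x) ≡ traceNodeLabel x
    vlab-ok′ (positionN r x) = refl
    vlab-ok′ (controlN i)    = cong (λ n → stateLabel (Config.pc (trace P n))) (toℕ-inject₁ i)

  nodeOf-grow : ∀ {m} {A : Graph signature} (f : Hom A (T m)) v →
                nodeOf (traceGraph (suc m)) (grow m ∘H f) v ≡ growNode (nodeOf (traceGraph m) f v)
  nodeOf-grow {m} f v = strictlyInverseʳ (nodeIndex (traceGraph (suc m))) _

  open Follow T grow

  -- How the new nodes and edges of a right-hand side are placed one step later in the trace,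
  -- given the placement `old` of the interface.
  record Continuation {K : Graph signature} (X : Extension (nodes K)) {m} (old : Fin (nodes K) → TraceNode (suc m)) : Set where
    field
      newNode       : Fin (newNodes X) → TraceNode (suc m)
      newEdge       : Fin (newEdges X) → TraceEdge (suc m)
      newEnd-ok     : ∀ s i → traceEnd s (newEdge i) ≡ [ newNode , old ]′ (newEnd X s i)
      newNode-label : ∀ i → traceNodeLabel (newNode i) ≡ newVlab X i
      newEdge-label : ∀ i → traceEdgeLabel (newEdge i) ≡ newElab X i

  Continues : (K : Graph signature) → Extension (nodes K) → Extension (nodes K) → Set
  Continues K XL XR = ∀ {m} (f : Hom (extend K XL id) (T m)) →
                      Continuation {K} XR {m} (λ κ → growNode (nodeOf (traceGraph m) f (newNodes XL ↑ʳ κ)))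

  follows : ∀ {K : Graph signature} (XL XR : Extension (nodes K)) → Continues K XL XR → Follows (extensionRule K XL XR)
  follows {K} XL XR continue m f =
    copairInto (traceGraph (suc m)) XR id (grow m ∘H (f ∘H embed K XL id)) newNode newEdge
      (λ s i → trans (newEnd-ok s i) ([,]-cong (λ _ → refl) (sym ∘ nodeOf-grow (f ∘H embed K XL id)) (newEnd XR s i)))
      newNode-label newEdge-label
    where open Continuation (continue f)

  pointerEdge⁻¹ : ∀ {m} (ε : TraceEdge m) r → traceEdgeLabel ε ≡ pointerLabel r →
                  Σ (Fin (suc m)) λ i → ε ≡ pointerE r i
  pointerEdge⁻¹ (pointerE r′ i) r eq with pointerLabel-injective eq
  ... | refl = i , refl
  pointerEdge⁻¹ (succE _ _) r₀ ()
  pointerEdge⁻¹ (succE _ _) r₁ ()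
  pointerEdge⁻¹ (zeroE _)   r₀ ()
  pointerEdge⁻¹ (zeroE _)   r₁ ()

  succEdge⁻¹ : ∀ {m} (ε : TraceEdge m) {r y} → traceEdgeLabel ε ≡ succLabel → traceEnd target ε ≡ positionN r y →
               Σ (Fin m) λ x → ε ≡ succE r x × suc x ≡ y
  succEdge⁻¹ (succE r x) _ refl = x , refl , refl
  succEdge⁻¹ (zeroE _)      ()
  succEdge⁻¹ (pointerE r₀ _) ()
  succEdge⁻¹ (pointerE r₁ _) ()

  zeroEdge⁻¹ : ∀ {m} (ε : TraceEdge m) {r y} → traceEdgeLabel ε ≡ zeroLabel → traceEnd source ε ≡ positionN r y →
               y ≡ zero
  zeroEdge⁻¹ (zeroE r)      _ refl = refl
  zeroEdge⁻¹ (succE _ _)    ()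
  zeroEdge⁻¹ (pointerE r₀ _) ()
  zeroEdge⁻¹ (pointerE r₁ _) ()

  module Match {m} {K : Graph signature} {q} {at : Reg → Fin (nodes K)}
               (f : Hom (extend K (control q at) id) (T m)) where

    private
      F = traceGraph m
      L′ = extend K (control q at) id

    pointer : Reg → Fin (2 + edges K)
    pointer r = toFin2 r ↑ˡ edges K

    pointer-image : ∀ r → Σ (Fin (suc m)) λ i → edgeOf F f (pointer r) ≡ pointerE r i
    pointer-image r = pointerEdge⁻¹ _ r
      (trans (elab-ok f (pointer r))
             (trans (caseFin-↑ˡ (pointerLabel ∘ fromFin2) (elab K) (toFin2 r)) (cong pointerLabel (fromFin2-toFin2 r))))

    pointer-end : ∀ r s → nodeOf F f (end s L′ (pointer r)) ≡ traceEnd s (pointerE r (proj₁ (pointer-image r)))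
    pointer-end r s = trans (sym (nodeOf-end F f s (pointer r))) (cong (traceEnd s) (proj₂ (pointer-image r)))

    control↦ : ∀ r → nodeOf F f zero ≡ controlN (proj₁ (pointer-image r))
    control↦ r = trans (cong (nodeOf F f) (sym (end-extend-↑ˡ K (control q at) id source (toFin2 r)))) (pointer-end r source)

    -- The time of the configuration that the match reads.
    time : Fin (suc m)
    time = proj₁ (pointer-image r₀)

    position↦ : ∀ r → nodeOf F f (1 ↑ʳ at r) ≡ positionN r (counterAt time r)
    position↦ r =
      trans (cong (nodeOf F f) (sym (trans (end-extend-↑ˡ K (control q at) id target (toFin2 r))
                                           (cong ((1 ↑ʳ_) ∘ at) (fromFin2-toFin2 r)))))
            (trans (pointer-end r target) (cong (λ i → positionN r (counterAt i r)) same-time))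
      where
      same-time : proj₁ (pointer-image r) ≡ time
      same-time = inj₂-injective (trans (sym (control↦ r)) (control↦ r₀))

    time-pc : q < length P → Config.pc (trace P (toℕ time)) ≡ q
    time-pc q<len = stateLabel-injective q<len (trans (sym (cong traceNodeLabel (control↦ r₀))) (vlab-ok f zero))

    interface-end : ∀ s d → traceEnd s (edgeOf F f (2 ↑ʳ d)) ≡ nodeOf F f (1 ↑ʳ end s K d)
    interface-end s d = trans (nodeOf-end F f s (2 ↑ʳ d)) (cong (nodeOf F f) (end-extend-↑ʳ K (control q at) id s d))

    interface-label : ∀ d → traceEdgeLabel (edgeOf F f (2 ↑ʳ d)) ≡ elab K d
    interface-label d = trans (elab-ok f (2 ↑ʳ d)) (caseFin-↑ʳ (pointerLabel ∘ fromFin2) (elab K) d)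

    module Executing {instr} (fetch : nth P q ≡ just instr) where

      c : Config
      c = trace P (toℕ time)

      trace-next : trace P (suc (toℕ time)) ≡ exec instr c
      trace-next = trace-suc P (toℕ time) (trans (cong (nth P) (time-pc (nth-just⇒< P fetch))) fetch)

      old : Fin (nodes K) → TraceNode (suc m)
      old κ = growNode (nodeOf F f (1 ↑ʳ κ))

      old-position : ∀ r → old (at r) ≡ positionN r (inject₁ (counterAt time r))
      old-position r = cong growNode (position↦ r)

      advance : ∀ r {y} → toℕ y ≡ counter r (exec instr c) → counterAt (suc time) r ≡ y
      advance r eq = counterAt-≡ (suc time) r (trans eq (sym (cong (counter r) trace-next)))

      unchanged : ∀ r → counter r (exec instr c) ≡ counter r c → positionN r (counterAt (suc time) r) ≡ old (at r)
      unchanged r eq =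
        trans (cong (positionN r) (advance r (trans (toℕ-inject₁ _) (trans (toℕ-fromℕ< _) (sym eq)))))
              (sym (old-position r))

      controlContinuation : ∀ j (position : Reg → Fin (nodes K)) → Config.pc (exec instr c) ≡ j →
                            (∀ r → positionN r (counterAt (suc time) r) ≡ old (position r)) →
                            Continuation {K} (control j position) old
      controlContinuation j position pc≡ targets = record
        { newNode       = λ _ → controlN (suc time)
        ; newEdge       = λ e → pointerE (fromFin2 e) (suc time)
        ; newEnd-ok     = λ { source _ → refl ; target e → targets (fromFin2 e) }
        ; newNode-label = λ _ → cong stateLabel (trans (cong Config.pc trace-next) pc≡)
        ; newEdge-label = λ _ → refl }

  incrementContinues : ∀ {q r j} → nth P q ≡ just (inc r j) →
                       Continues counterPositions (control q toFin2) (increment r j)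
  incrementContinues {q} {r} {j} fetch f = record
    { newNode       = newNode
    ; newEdge       = λ { zero → pointerE r₀ (suc time) ; (suc zero) → pointerE r₁ (suc time)
                        ; (suc (suc _)) → succE r (counterAt time r) }
    ; newEnd-ok     = λ { source zero → refl ; source (suc zero) → refl ; source (suc (suc zero)) → sym (old-position r)
                        ; target zero → pointer-target r₀ ; target (suc zero) → pointer-target r₁
                        ; target (suc (suc zero)) → cong (positionN r) (sym (advance r incremented)) }
    ; newNode-label = λ { zero → cong (stateLabel ∘ Config.pc) trace-next ; (suc _) → refl }
    ; newEdge-label = λ { zero → refl ; (suc zero) → refl ; (suc (suc zero)) → refl } }
    where
    open Match {at = toFin2} f
    open Executing fetch
    newNode : Fin 2 → TraceNode _
    newNode zero    = controlN (suc time)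
    newNode (suc _) = positionN r (counterAt (suc time) r)
    incremented : toℕ (suc (counterAt time r)) ≡ counter r (exec (inc r j) c)
    incremented = trans (cong suc (toℕ-fromℕ< _)) (sym (trans (counter-goto r j _) (counter-setCounter-same r _ c)))
    pointer-target : ∀ r′ → positionN r′ (counterAt (suc time) r′) ≡ [ newNode , old ]′ (incrementedPosition r r′)
    pointer-target r′ with r′ ≟ᴿ r
    ... | yes refl rewrite incrementedPosition-same r = refl
    ... | no r′≢r  rewrite incrementedPosition-other r′≢r =
      unchanged r′ (trans (counter-goto r′ j _) (counter-setCounter-other _ c r′≢r))

  decrementContinues : ∀ {q r j k} → nth P q ≡ just (dec r j k) →
                       Continues (predecessorOf r) (control q (suc ∘ toFin2)) (control j (update (suc ∘ toFin2) r zero))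
  decrementContinues {q} {r} {j} {k} fetch {m} f =
    controlContinuation j (update (suc ∘ toFin2) r zero) (cong Config.pc decremented) pointer-target
    where
    open Match {at = suc ∘ toFin2} f
    open Executing fetch
    succ-image = succEdge⁻¹ (edgeOf (traceGraph m) f (2 ↑ʳ zero)) (interface-label zero)
                            (trans (interface-end target zero) (position↦ r))
    x = proj₁ succ-image
    predecessor↦ : old zero ≡ positionN r (inject₁ (inject₁ x))
    predecessor↦ = cong growNode (trans (sym (interface-end source zero))
                                        (cong (traceEnd source) (proj₁ (proj₂ succ-image))))
    decremented : exec (dec r j k) c ≡ goto j (setCounter r (toℕ x) c)
    decremented = exec-dec-suc {r} {j} {k} {c} (trans (sym (toℕ-fromℕ< _)) (cong toℕ (sym (proj₂ (proj₂ succ-image)))))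
    pointer-target : ∀ r′ → positionN r′ (counterAt (suc time) r′) ≡ old (update (suc ∘ toFin2) r zero r′)
    pointer-target r′ with r′ ≟ᴿ r
    ... | yes refl =
      trans (cong (positionN r) (advance r (trans (trans (toℕ-inject₁ _) (toℕ-inject₁ x))
                                                  (sym (trans (cong (counter r) decremented)
                                                              (trans (counter-goto r j _) (counter-setCounter-same r _ c)))))))
            (trans (sym predecessor↦) (cong old (sym (update-same (suc ∘ toFin2) r zero))))
    ... | no r′≢r  =
      trans (unchanged r′ (trans (cong (counter r′) decremented)
                                 (trans (counter-goto r′ j _) (counter-setCounter-other _ c r′≢r))))
            (cong old (sym (update-other (suc ∘ toFin2) zero r′≢r)))

  zeroTestContinues : ∀ {q r j k} → nth P q ≡ just (dec r j k) →
                      Continues (zeroLoopAt r) (control q toFin2) (control k toFin2)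
  zeroTestContinues {q} {r} {j} {k} fetch {m} f =
    controlContinuation k toFin2 (cong Config.pc jumped)
      (λ r′ → unchanged r′ (trans (cong (counter r′) jumped) (counter-goto r′ k c)))
    where
    open Match {at = toFin2} f
    open Executing fetch
    jumped : exec (dec r j k) c ≡ goto k c
    jumped = exec-dec-zero {r} {j} {k} {c} (trans (sym (toℕ-fromℕ< _)) (cong toℕ
               (zeroEdge⁻¹ (edgeOf (traceGraph m) f (2 ↑ʳ zero)) (interface-label zero)
                           (trans (interface-end source zero) (position↦ r)))))

  instructionRules-follow : ∀ {ρ q i} → nth P q ≡ just i → ρ ∈ rulesFor q i → Follows ρ
  instructionRules-follow {q = q} {inc r j}   fetch (here refl) =
    follows (control q toFin2) (increment r j) (incrementContinues fetch)
  instructionRules-follow {q = q} {dec r j k} fetch (here refl) =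
    follows (control q (suc ∘ toFin2)) (control j (update (suc ∘ toFin2) r zero)) (decrementContinues fetch)
  instructionRules-follow {q = q} {dec r j k} fetch (there (here refl)) =
    follows (control q toFin2) (control k toFin2) (zeroTestContinues fetch)

  grammarRules-follow : ∀ {ρ} → ρ ∈R rulesFrom 0 P → Follows ρ
  grammarRules-follow ρ∈ with rulesFrom⊆rulesFor 0 P (∈R⇒∈ ρ∈)
  ... | n , i , fetch , ρ∈i = instructionRules-follow fetch ρ∈i

  startHom : Hom (start grammar) (T 0)
  startHom = homInto (traceGraph 0) node edge ends-ok
    (λ { zero → refl ; (suc zero) → refl ; (suc (suc zero)) → refl })
    (λ { zero → refl ; (suc zero) → refl ; (suc (suc zero)) → refl ; (suc (suc (suc zero))) → refl })
    where
    node : Fin 3 → TraceNode 0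
    node zero    = controlN zero
    node (suc κ) = positionN (fromFin2 κ) zero
    edge : Fin 4 → TraceEdge 0
    edge zero          = pointerE r₀ zero
    edge (suc zero)    = pointerE r₁ zero
    edge (suc (suc κ)) = zeroE (fromFin2 κ)
    ends-ok : ∀ s e → traceEnd s (edge e) ≡ node (end s (start grammar) e)
    ends-ok source zero                   = refl
    ends-ok source (suc zero)             = refl
    ends-ok source (suc (suc zero))       = refl
    ends-ok source (suc (suc (suc zero))) = refl
    ends-ok target zero                   = refl
    ends-ok target (suc zero)             = refl
    ends-ok target (suc (suc zero))       = refl
    ends-ok target (suc (suc (suc zero))) = refl

  halt-node⇒halts : ∀ {m} (x : TraceNode m) → traceNodeLabel x ≡ haltLabel → Halts P
  halt-node⇒halts (positionN r₀ _) ()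
  halt-node⇒halts (positionN r₁ _) ()
  halt-node⇒halts (controlN i)     eq = trace-exit⇒halts P (toℕ i) (stateLabel-halt⁻¹ eq)

  soundness : SubgraphClosure (InLang grammar) haltNode → Halts P
  soundness (H , (derivation , _) , (h , _)) =
    let (m , φ) = follow-derivation grammarRules-follow derivation startHom
    in halt-node⇒halts (nodeOf (traceGraph m) φ (vmap h zero)) (trans (vlab-ok φ (vmap h zero)) (vlab-ok h zero))

mainTheorem10 :
    (decide : (S : Signature) (𝒢 : Grammar S) (G : Graph S) →
              Dec (SubgraphClosure (InLang 𝒢) G)) →
    (P : Program) → Dec (Halts P)
mainTheorem10 decide P with decide (Encoding.signature P) (Encoding.grammar P) (Encoding.haltNode P)
... | yes member    = yes (Soundness.soundness P member)
... | no nonMember = no (nonMember ∘ Completeness.completeness P)
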